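{- Let $A_1,A_2$ be the $6\times6$ matrices over $\mathbb{R}_{\max}$ whose only entries different from $\varepsilon=-\infty$ are the following. For $A_1$: $(A_1)_{1,2}=(A_1)_{2,1}=0$ and $(A_1)_{1,3}=(A_1)_{2,5}=(A_1)_{3,4}=(A_1)_{4,1}=(A_1)_{5,6}=(A_1)_{6,2}=-100$. For $A_2$: $(A_2)_{1,2}=(A_2)_{2,1}=0$, $(A_2)_{1,3}=(A_2)_{3,4}=(A_2)_{5,6}=(A_2)_{6,2}=-100$ and $(A_2)_{2,5}=(A_2)_{4,1}=-1$. (Their common associated digraph is primitive, and their common critical digraph is the cycle $1\to2\to1$, of cyclicity $2$.) Then for every $t\ge2$ the product $(A_1)^{2t}\otimes A_2$ is not CSR, and for every $t\ge1$ the product $(A_1)^{2t+1}\otimes A_2$ is not CSR. Consequently, there are arbitrarily long products of matrices from $\{A_1,A_2\}$ that are not CSR.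
   Context: $\mathbb{R}_{\max}=\mathbb{R}\cup\{ -\infty\}$ with $a\oplus b=\max(a,b)$, $a\otimes b=a+b$; $(A\otimes B)_{i,j}=\max_l(a_{i,l}+b_{l,j})$; matrix powers are tropical and $A^0=I$ ($0$ on the diagonal, $\varepsilon$ elsewhere). The digraph associated with a square matrix $A$ has an edge $(i,j)$ of weight $a_{i,j}$ iff $a_{i,j}\ne\varepsilon$. The critical digraph of $A$ consists of all nodes and edges on cycles whose mean weight (weight/length) is maximal. The cyclicity of a strongly connected digraph is the gcd of its cycle lengths; it is primitive if this is $1$. CSR: let $\mathcal{E}_c$ be the edge set of the common critical digraph of the matrices in the set, $\gamma$ its cyclicity, $S$ the matrix with $S_{i,j}=0$ for $(i,j)\in\mathcal{E}_c$ and $\varepsilon$ otherwise, $T(S)$ the least $T$ with $S^{l+\gamma}=S^l$ for all $l\ge T$, and $t_0$ any integer with $t_0\gamma\ge T(S)$. For a product $\Gamma(k)$ of $k$ matrices from the set, and $k\,(\mathrm{mod}\,\gamma)\in\{0,\dots,\gamma-1\}$, put $C=\Gamma(k)\otimes S^{(t_0+1)\gamma-k(\mathrm{mod}\,\gamma)}$ and $R=S^{(t_0+1)\gamma-k(\mathrm{mod}\,\gamma)}\otimes\Gamma(k)$. $\Gamma(k)$ is called CSR if $\Gamma(k)=C\otimes S^{k(\mathrm{mod}\,\gamma)}\otimes R$. -}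

module Defs where

open import Data.Fin.Base using (Fin)
open import Data.Fin.Patterns using (0F; 1F)
open import Data.Fin.Properties using (_≟_)
open import Data.Integer.Base as ℤ using (ℤ; +_)
open import Data.List.Base as List using (List; []; _∷_)
open import Data.List.Membership.Propositional using (_∈_)
open import Data.List.Relation.Unary.Unique.Propositional using (Unique)
open import Data.Nat.Base as ℕ using (ℕ; zero; suc; NonZero)
open import Data.Nat.Divisibility using (_∣_)
open import Data.Nat.DivMod using (_%_)
open import Data.Nat.Tactic.RingSolver using (solve-∀)
open import Data.Product.Base using (∃-syntax; _×_; _,_; proj₁)
open import Data.Rational.Unnormalised.Base as ℚ using (ℚᵘ; mkℚᵘ)
import Data.Rational.Unnormalised.Properties as ℚ
open import Data.Rational.Unnormalised.Solver using (module +-*-Solver)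
open import Data.Vec.Base as Vec using (Vec; []; _∷_)
import Data.Vec.Functional as Vector
open import Level using (0ℓ)
open import Relation.Binary.Construct.Add.Infimum.Equality using () renaming (_≈₋_ to Lift≈)
open import Relation.Binary.Construct.Add.Infimum.NonStrict using () renaming (_≤₋_ to Lift≤)
open import Relation.Binary.Construct.Closure.ReflexiveTransitive using (Star; _◅_)
  renaming (ε to stop)
open import Relation.Binary.Core using (Rel; _⇔_)
open import Relation.Binary.PropositionalEquality using (_≡_; _≢_; cong)
open import Relation.Nullary.Construct.Add.Infimum using (_₋; ⊥₋; [_])
open import Relation.Nullary.Decidable using (yes; no)
open import Relation.Nullary.Negation using (¬_)
open import Relation.Unary using (Pred; U; _≐_; ｛_｝; _∪_)

-- Real numbers as in Bishop: Cauchy sequences of rationals with the fixed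
-- modulus |xₘ - xₙ| ≤ 1/(m+1) + 1/(n+1), compared up to a setoid equality.

δ : ℕ → ℚᵘ
δ n = mkℚᵘ (+ 1) n

-- The one-sided bound suffices: exchanging m and n gives the other side.
record ℝ : Set where
  constructor mkℝ
  field
    seq     : ℕ → ℚᵘ
    regular : ∀ m n → seq m ℚ.≤ seq n ℚ.+ (δ m ℚ.+ δ n)

open ℝ public

infix 4 _≤ᴿ_ _≈ᴿ_

_≤ᴿ_ : Rel ℝ 0ℓ
x ≤ᴿ y = ∀ n → seq x n ℚ.≤ seq y n ℚ.+ (δ n ℚ.+ δ n)

_≈ᴿ_ : Rel ℝ 0ℓ
x ≈ᴿ y = x ≤ᴿ y × y ≤ᴿ x

fromℚ : ℚᵘ → ℝ
fromℚ q = mkℝ (λ _ → q) λ m n →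
  ℚ.≤-respʳ-≃ (ℚ.+-comm (δ m ℚ.+ δ n) q) (ℚ.p≤q+p q (δ m ℚ.+ δ n))

fromℤ : ℤ → ℝ
fromℤ z = fromℚ (mkℚᵘ z 0)

-- Sampling a sum at index 2n+1 keeps the modulus: 1/(2n+2) + 1/(2n+2) = 1/(n+1).
double : ℕ → ℕ
double n = suc (n ℕ.+ n)

δ-double : ∀ n → δ (double n) ℚ.+ δ (double n) ℚ.≃ δ n
δ-double n = ℚ.*≡* (cong +_ (lemma n))
  where
  lemma : ∀ n → (1 ℕ.* (2 ℕ.+ (n ℕ.+ n)) ℕ.+ 1 ℕ.* (2 ℕ.+ (n ℕ.+ n))) ℕ.* (1 ℕ.+ n)
              ≡ 1 ℕ.* ((2 ℕ.+ (n ℕ.+ n)) ℕ.* (2 ℕ.+ (n ℕ.+ n)))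
  lemma = solve-∀

infixl 6 _+ᴿ_ _⊔ᴿ_
infixl 7 _÷ᴿ_

_+ᴿ_ : ℝ → ℝ → ℝ
x +ᴿ y = mkℝ (λ n → seq x (double n) ℚ.+ seq y (double n)) λ m n →
  let m′ = double m; n′ = double n in
  ℚ.≤-respʳ-≃
    (ℚ.≃-trans (regroup (seq x n′) (seq y n′) (δ m′) (δ n′))
               (ℚ.+-congʳ (seq x n′ ℚ.+ seq y n′) (ℚ.+-cong (δ-double m) (δ-double n))))
    (ℚ.+-mono-≤ (regular x m′ n′) (regular y m′ n′))
  where
  regroup : ∀ a b c d → (a ℚ.+ (c ℚ.+ d)) ℚ.+ (b ℚ.+ (c ℚ.+ d))
                      ℚ.≃ (a ℚ.+ b) ℚ.+ ((c ℚ.+ c) ℚ.+ (d ℚ.+ d))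
  regroup = solve 4 (λ a b c d → (a :+ (c :+ d)) :+ (b :+ (c :+ d))
                              := (a :+ b) :+ ((c :+ c) :+ (d :+ d))) ℚ.≃-refl
    where open +-*-Solver

_⊔ᴿ_ : ℝ → ℝ → ℝ
x ⊔ᴿ y = mkℝ (λ n → seq x n ℚ.⊔ seq y n) λ m n → ℚ.⊔-lub
  (ℚ.≤-trans (regular x m n) (ℚ.+-monoˡ-≤ (δ m ℚ.+ δ n) (ℚ.p≤p⊔q (seq x n) (seq y n))))
  (ℚ.≤-trans (regular y m n) (ℚ.+-monoˡ-≤ (δ m ℚ.+ δ n) (ℚ.p≤q⊔p (seq x n) (seq y n))))

_÷ᴿ_ : ℝ → (k : ℕ) → .{{NonZero k}} → ℝ
x ÷ᴿ suc k = mkℝ (λ n → seq x n ℚ.* δ k) λ m n →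
  let e = δ m ℚ.+ δ n in
  ℚ.≤-trans (ℚ.*-monoˡ-≤-nonNeg (δ k) (regular x m n))
  (ℚ.≤-trans (ℚ.≤-reflexive (ℚ.*-distribʳ-+ (δ k) (seq x n) e))
  (ℚ.+-monoʳ-≤ (seq x n ℚ.* δ k)
    (ℚ.≤-respʳ-≃ (ℚ.*-identityʳ e) (ℚ.*-monoʳ-≤-nonNeg e δ≤1))))
  where
  δ≤1 : δ k ℚ.≤ ℚ.1ℚᵘ
  δ≤1 = ℚ.*≤* (ℤ.+≤+ (ℕ.s≤s ℕ.z≤n))

-- The max-plus semiring ℝ ∪ {-∞}.

ℝmax : Set
ℝmax = ℝ ₋

pattern ε = ⊥₋

infix 4 _≈_ _≤_ _≈ₘ_
infixl 6 _⊕_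
infixl 7 _⊗_ _⊗ₘ_
infixr 8 _^_

_≈_ _≤_ : Rel ℝmax 0ℓ
_≈_ = Lift≈ _≈ᴿ_
_≤_ = Lift≤ _≤ᴿ_

_⊕_ : ℝmax → ℝmax → ℝmax
ε     ⊕ b     = b
[ a ] ⊕ ε     = [ a ]
[ a ] ⊕ [ b ] = [ a ⊔ᴿ b ]

_⊗_ : ℝmax → ℝmax → ℝmax
ε     ⊗ _     = ε
[ a ] ⊗ ε     = ε
[ a ] ⊗ [ b ] = [ a +ᴿ b ]

_÷_ : ℝmax → (k : ℕ) → .{{NonZero k}} → ℝmax
ε     ÷ k = ε
[ a ] ÷ k = [ a ÷ᴿ k ]

𝟘 : ℝmax
𝟘 = [ fromℤ (+ 0) ]

Matrix : ℕ → Set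
Matrix n = Fin n → Fin n → ℝmax

_≈ₘ_ : ∀ {n} → Rel (Matrix n) 0ℓ
A ≈ₘ B = ∀ i j → A i j ≈ B i j

_⊗ₘ_ : ∀ {n} → Matrix n → Matrix n → Matrix n
(A ⊗ₘ B) i j = Vector.foldr _⊕_ ε (λ l → A i l ⊗ B l j)

I : ∀ {n} → Matrix n
I i j with i ≟ j
... | yes _ = 𝟘
... | no  _ = ε

_^_ : ∀ {n} → Matrix n → ℕ → Matrix n
A ^ zero  = I
A ^ suc k = A ⊗ₘ A ^ k

⨂ : ∀ {n k} → Vec (Matrix n) k → Matrix n
⨂ = Vec.foldr _ _⊗ₘ_ I

record Digraph (n : ℕ) : Set₁ where
  field
    Node : Pred (Fin n) 0ℓ
    Edge : Rel (Fin n) 0ℓ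

open Digraph public

infix 4 _≐ᴳ_

_≐ᴳ_ : ∀ {n} → Digraph n → Digraph n → Set
G ≐ᴳ H = Node G ≐ Node H × Edge G ⇔ Edge H

edges : ∀ {n} {E : Rel (Fin n) 0ℓ} {i j} → Star E i j → List (Fin n × Fin n)
edges stop                      = []
edges (_◅_ {i = i} {j = j} _ w) = (i , j) ∷ edges w

record Cycle {n} (G : Digraph n) : Set where
  field
    base : Fin n
    walk : Star (Edge G) base base

  nodes : List (Fin n)
  nodes = List.map proj₁ (edges walk)

  length : ℕ
  length = List.length (edges walk)

  field
    .{{nonEmpty}} : NonZero length
    elementary    : Unique nodes

open Cycle public

StronglyConnected : ∀ {n} → Digraph n → Set
StronglyConnected G = ∀ {i j} → Node G i → Node G j → Star (Edge G) i j

record IsCyclicity {n} (G : Digraph n) (γ : ℕ) : Set where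
  field
    stronglyConnected : StronglyConnected G
    divides           : ∀ (c : Cycle G) → γ ∣ length c
    greatest          : ∀ d → (∀ (c : Cycle G) → d ∣ length c) → d ∣ γ

Primitive : ∀ {n} → Digraph n → Set
Primitive G = IsCyclicity G 1

associated : ∀ {n} → Matrix n → Digraph n
associated A = record { Node = U ; Edge = λ i j → A i j ≢ ε }

weight : ∀ {n} (A : Matrix n) → Cycle (associated A) → ℝmax
weight A c = List.foldr (λ (i , j) → A i j ⊗_) 𝟘 (edges (walk c))

mean : ∀ {n} (A : Matrix n) → Cycle (associated A) → ℝmax
mean A c = weight A c ÷ length c

MaximalMean : ∀ {n} (A : Matrix n) → Pred (Cycle (associated A)) 0ℓ
MaximalMean A c = ∀ c′ → mean A c′ ≤ mean A c

critical : ∀ {n} → Matrix n → Digraph n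
critical A = record
  { Node = λ i   → ∃[ c ] MaximalMean A c × i ∈ nodes c
  ; Edge = λ i j → ∃[ c ] MaximalMean A c × (i , j) ∈ edges (walk c)
  }

-- The data entering the CSR decomposition for a set 𝒳 of matrices with a
-- common critical digraph. All of it except t₀ is determined by 𝒳. As
-- t₀γ ≥ T ≥ 0 with γ > 0, the integer t₀ is a natural number.
record CSRData {n} (𝒳 : Pred (Matrix n) 0ℓ) : Set₁ where
  field
    common   : Digraph n
    isCommon : ∀ {A} → 𝒳 A → critical A ≐ᴳ common

    γ               : ℕ
    .{{γ-nonZero}}  : NonZero γ
    isCyclicity     : IsCyclicity common γ

    S          : Matrix n
    S-edge     : ∀ {i j} → Edge common i j → S i j ≡ 𝟘
    S-nonEdge  : ∀ {i j} → ¬ Edge common i j → S i j ≡ ε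

  PeriodicFrom : Pred ℕ 0ℓ
  PeriodicFrom T = ∀ l → T ℕ.≤ l → S ^ (l ℕ.+ γ) ≈ₘ S ^ l

  field
    T          : ℕ
    T-periodic : PeriodicFrom T
    T-least    : ∀ T′ → PeriodicFrom T′ → T ℕ.≤ T′

    t₀    : ℕ
    t₀γ≥T : T ℕ.≤ t₀ ℕ.* γ

-- The subtraction in v is never truncated, since k % γ < γ.
CSR : ∀ {n} (𝒳 : Pred (Matrix n) 0ℓ) → ℕ → Matrix n → Set₁
CSR 𝒳 k Γ = ∃[ D ] (let open CSRData {𝒳 = 𝒳} D
                        v = suc t₀ ℕ.* γ ℕ.∸ k % γ
                        C = Γ ⊗ₘ S ^ v
                        R = S ^ v ⊗ₘ Γ
                    in Γ ≈ₘ C ⊗ₘ S ^ (k % γ) ⊗ₘ R)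

-1ᵐ -100ᵐ : ℝmax
-1ᵐ   = [ fromℤ (ℤ.- + 1) ]
-100ᵐ = [ fromℤ (ℤ.- + 100) ]

fromRows : ∀ {n} → Vec (Vec ℝmax n) n → Matrix n
fromRows rows i j = Vec.lookup (Vec.lookup rows i) j

A₁ A₂ : Matrix 6
A₁ = fromRows
  ( (ε     ∷ 𝟘     ∷ -100ᵐ ∷ ε     ∷ ε     ∷ ε     ∷ [])
  ∷ (𝟘     ∷ ε     ∷ ε     ∷ ε     ∷ -100ᵐ ∷ ε     ∷ [])
  ∷ (ε     ∷ ε     ∷ ε     ∷ -100ᵐ ∷ ε     ∷ ε     ∷ [])
  ∷ (-100ᵐ ∷ ε     ∷ ε     ∷ ε     ∷ ε     ∷ ε     ∷ [])
  ∷ (ε     ∷ ε     ∷ ε     ∷ ε     ∷ ε     ∷ -100ᵐ ∷ [])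
  ∷ (ε     ∷ -100ᵐ ∷ ε     ∷ ε     ∷ ε     ∷ ε     ∷ [])
  ∷ [])
A₂ = fromRows
  ( (ε     ∷ 𝟘     ∷ -100ᵐ ∷ ε     ∷ ε     ∷ ε     ∷ [])
  ∷ (𝟘     ∷ ε     ∷ ε     ∷ ε     ∷ -1ᵐ   ∷ ε     ∷ [])
  ∷ (ε     ∷ ε     ∷ ε     ∷ -100ᵐ ∷ ε     ∷ ε     ∷ [])
  ∷ (-1ᵐ   ∷ ε     ∷ ε     ∷ ε     ∷ ε     ∷ ε     ∷ [])
  ∷ (ε     ∷ ε     ∷ ε     ∷ ε     ∷ ε     ∷ -100ᵐ ∷ [])
  ∷ (ε     ∷ -100ᵐ ∷ ε     ∷ ε     ∷ ε     ∷ ε     ∷ [])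
  ∷ [])

𝒜 : Pred (Matrix 6) 0ℓ
𝒜 = ｛ A₁ ｝ ∪ ｛ A₂ ｝

-- Nodes are numbered from 0: this is the cycle 1 → 2 → 1 of the matrices above.
twoCycle : Digraph 6
twoCycle = record
  { Node = ｛ 0F ｝ ∪ ｛ 1F ｝
  ; Edge = λ i j → (｛ 0F , 1F ｝ ∪ ｛ 1F , 0F ｝) (i , j)
  }

module Submission where

-- Every entry occurring here is an integer or −∞, so all products can be
-- computed over ℤ ∪ {−∞}, where equality is decidable. There the powers of A₁
-- have period 2 from A₁⁷ on and those of S from S¹ on, which leaves finitely
-- many evaluations. With nodes numbered from 1, for even k the CSR expression
-- of A₁ᵏ ⊗ A₂ has entry (1,5) equal to −202: it concatenates a walk 1 → 1 ending
-- in 4 → 1 with one from 2 ending in 2 → 5, each using a cheap edge of A₂. A walk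
-- 1 → 5 of the product itself can use a cheap edge only in its last step, and has
-- to pay −300 for an odd cycle before. For odd k the same happens at entry (2,5).

open import Defs
open import Data.Fin.Base using (Fin; zero; suc)
open import Data.Fin.Patterns using (0F; 1F; 2F; 3F; 4F; 5F)
open import Data.Fin.Properties using (_≟_; all?)
open import Data.Integer.Base as ℤ using (ℤ; +_; -[1+_])
import Data.Integer.Properties as ℤ
open import Data.List.Base as List using (List; []; _∷_)
open import Data.List.Membership.Propositional using (_∈_)
open import Data.List.Membership.Propositional.Properties using (∈-map⁻)
open import Data.List.Relation.Unary.All using ([]; _∷_)
open import Data.List.Relation.Unary.AllPairs using ([]; _∷_)
open import Data.List.Relation.Unary.Any using (here; there)
open import Data.Nat.Base as ℕ using (ℕ; zero; suc; NonZero; z≤n; s≤s; _+_; _*_)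
  renaming (_≤_ to _≤ℕ_)
open import Data.Nat.Divisibility using (_∣_; 1∣_; _∣0; ∣-refl; ∣m∣n⇒∣m+n; ∣m+n∣m⇒∣n; ∣-antisym)
open import Data.Nat.DivMod using (_%_; [m+kn]%n≡m%n; m%n<n)
open import Data.Nat.GeneralisedArithmetic using (fold)
import Data.Nat.Properties as ℕ
open import Data.Nat.Tactic.RingSolver using (solve-∀)
open import Data.Product.Base using (∃-syntax; _×_; _,_; proj₁; proj₂)
open import Data.Product.Properties using () renaming (≡-dec to ≡-dec-×)
open import Data.Rational.Unnormalised.Base as ℚ using (mkℚᵘ; 0ℚᵘ)
import Data.Rational.Unnormalised.Properties as ℚ
open import Data.Rational.Unnormalised.Solver using (module +-*-Solver)
open import Data.Sum.Base using (_⊎_; inj₁; inj₂)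
open import Data.Vec.Base as Vec using (Vec; []; _∷_)
import Data.Vec.Functional as Vector
open import Data.Vec.Properties using (lookup-map)
open import Data.Vec.Relation.Unary.All using (All; []; _∷_)
open import Function.Base using (_∘_; case_of_)
open import Level using (0ℓ)
open import Relation.Binary.Construct.Add.Infimum.Equality using (⊥₋≈⊥₋; [_])
open import Relation.Binary.Construct.Add.Infimum.NonStrict as Lift using (⊥₋≤_; [_])
open import Relation.Binary.Construct.Closure.ReflexiveTransitive using (Star; _◅_; _◅◅_)
  renaming (ε to stop)
open import Relation.Binary.Definitions using (DecidableEquality; Decidable)
open import Relation.Binary.PropositionalEquality
  using (_≡_; _≢_; refl; sym; trans; cong; cong₂; subst; subst₂)
open import Relation.Nullary.Construct.Add.Infimum using (_₋; ⊥₋; [_]; ≡-dec)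
open import Relation.Nullary.Decidable
  using (Dec; yes; no; from-yes; ¬?; _×-dec_; _⊎-dec_; _→-dec_)
open import Relation.Nullary.Negation using (¬_; contradiction)
open import Relation.Unary using (Pred)

-- Max-plus algebra over ℤ

ℤmax : Set
ℤmax = ℤ ₋

infix 4 _≟ᶻ_ _≤ᶻ?_ _↝_ _↝ₘ_ _≋_
infixl 6 _⊕ᶻ_
infixl 7 _⊗ᶻ_ _⊗ᶻₘ_

_≟ᶻ_ : DecidableEquality ℤmax
_≟ᶻ_ = ≡-dec ℤ._≟_

open Lift ℤ._≤_ using () renaming (_≤₋_ to infix 4 _≤ᶻ_)

_≤ᶻ?_ : Decidable _≤ᶻ_
_≤ᶻ?_ = Lift.≤₋-dec ℤ._≤_ ℤ._≤?_

≤ᶻ-reflexive : ∀ {a b} → a ≡ b → a ≤ᶻ b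
≤ᶻ-reflexive = Lift.≤₋-reflexive-≡ ℤ._≤_ ℤ.≤-reflexive

≤ᶻ-trans : ∀ {a b c} → a ≤ᶻ b → b ≤ᶻ c → a ≤ᶻ c
≤ᶻ-trans = Lift.≤₋-trans ℤ._≤_ ℤ.≤-trans

_⊕ᶻ_ : ℤmax → ℤmax → ℤmax
⊥₋    ⊕ᶻ b     = b
[ a ] ⊕ᶻ ⊥₋    = [ a ]
[ a ] ⊕ᶻ [ b ] = [ a ℤ.⊔ b ]

_⊗ᶻ_ : ℤmax → ℤmax → ℤmax
⊥₋    ⊗ᶻ _     = ⊥₋
[ a ] ⊗ᶻ ⊥₋    = ⊥₋
[ a ] ⊗ᶻ [ b ] = [ a ℤ.+ b ]

⊗ᶻ-mono-≤ : ∀ {a b c d} → a ≤ᶻ b → c ≤ᶻ d → a ⊗ᶻ c ≤ᶻ b ⊗ᶻ d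
⊗ᶻ-mono-≤ (⊥₋≤ _) _       = ⊥₋≤ _
⊗ᶻ-mono-≤ [ _ ]   (⊥₋≤ _) = ⊥₋≤ _
⊗ᶻ-mono-≤ [ p ]   [ q ]   = [ ℤ.+-mono-≤ p q ]

ℤMatrix : ℕ → Set
ℤMatrix n = Fin n → Fin n → ℤmax

_⊗ᶻₘ_ : ∀ {n} → ℤMatrix n → ℤMatrix n → ℤMatrix n
(M ⊗ᶻₘ N) i j = Vector.foldr _⊕ᶻ_ ⊥₋ (λ l → M i l ⊗ᶻ N l j)

Iᶻ : ∀ {n} → ℤMatrix n
Iᶻ i j with i ≟ j
... | yes _ = [ + 0 ]
... | no  _ = ⊥₋

_≋_ : ∀ {n} → ℤMatrix n → ℤMatrix n → Set
M ≋ N = ∀ i j → M i j ≡ N i j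

_≋?_ : ∀ {n} → Decidable (_≋_ {n})
M ≋? N = all? λ i → all? λ j → M i j ≟ᶻ N i j

⊗ᶻₘ-cong : ∀ {n} {M M′ N N′ : ℤMatrix n} → M ≋ M′ → N ≋ N′ → M ⊗ᶻₘ N ≋ M′ ⊗ᶻₘ N′
⊗ᶻₘ-cong {M = M} {M′} {N} {N′} p q i j = go λ l → cong₂ _⊗ᶻ_ (p i l) (q l j)
  where
  go : ∀ {m} {f g : Fin m → ℤmax} → (∀ l → f l ≡ g l) →
       Vector.foldr _⊕ᶻ_ ⊥₋ f ≡ Vector.foldr _⊕ᶻ_ ⊥₋ g
  go {zero}  _ = refl
  go {suc _} h = cong₂ _⊕ᶻ_ (h zero) (go (h ∘ suc))

infixr 8 _⊗[_]_

-- One recursion serves two purposes: the seed `Iᶻ` gives the powers of `M`, mirroring `_^_`, and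
-- another seed gives a right-nested product ending in a different matrix.
_⊗[_]_ : ∀ {n} → ℤMatrix n → ℕ → ℤMatrix n → ℤMatrix n
M ⊗[ k ] X = fold X (M ⊗ᶻₘ_) k

module _ {n} {M X : ℤMatrix n} {p T : ℕ} (periodic : M ⊗[ p + T ] X ≋ M ⊗[ T ] X) where

  -- Left multiplication by `M` raises both exponents by one, so a single coincidence propagates to
  -- all later exponents.
  periodic-from : ∀ d → M ⊗[ d + (p + T) ] X ≋ M ⊗[ (d + T) ] X
  periodic-from zero    = periodic
  periodic-from (suc d) = ⊗ᶻₘ-cong (λ _ _ → refl) (periodic-from d)

  periodic-multiple : ∀ q → M ⊗[ q * p + T ] X ≋ M ⊗[ T ] X
  periodic-multiple zero    i j = refl
  periodic-multiple (suc q) i j =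
    trans (cong (λ k → (M ⊗[ k ] X) i j) shift)
          (trans (periodic-from (q * p) i j) (periodic-multiple q i j))
    where
    shift : suc q * p + T ≡ q * p + (p + T)
    shift = trans (cong (_+ T) (ℕ.+-comm p (q * p))) (ℕ.+-assoc (q * p) p T)

-- Elements of ℝmax represented by elements of ℤmax

-- The sequence representing the real need not be constant, but all its terms
-- equal the integer; this makes bounds on such reals free of limit arguments.
data _↝_ : ℝmax → ℤmax → Set where
  ε↝⊥₋ : ε ↝ ⊥₋
  [_]  : ∀ {x z} → (∀ n → seq x n ℚ.≃ mkℚᵘ z 0) → [ x ] ↝ [ z ]

_↝ₘ_ : ∀ {n} → Matrix n → ℤMatrix n → Set
A ↝ₘ M = ∀ i j → A i j ↝ M i j

ι : ℤmax → ℝmax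
ι ⊥₋    = ε
ι [ z ] = [ fromℤ z ]

ι-↝ : ∀ z → ι z ↝ z
ι-↝ ⊥₋    = ε↝⊥₋
ι-↝ [ z ] = [ (λ _ → ℚ.≃-refl) ]

≡ε⇒≡⊥₋ : ∀ {x z} → x ↝ z → x ≡ ε → z ≡ ⊥₋
≡ε⇒≡⊥₋ ε↝⊥₋ _ = refl

≡⊥₋⇒≡ε : ∀ {x z} → x ↝ z → z ≡ ⊥₋ → x ≡ ε
≡⊥₋⇒≡ε ε↝⊥₋ _ = refl

/1-mono-≤ : ∀ {c d} → c ℤ.≤ d → mkℚᵘ c 0 ℚ.≤ mkℚᵘ d 0
/1-mono-≤ c≤d = ℚ.*≤* (ℤ.*-monoʳ-≤-nonNeg (+ 1) c≤d)

↝-⊕ : ∀ {x y a b} → x ↝ a → y ↝ b → x ⊕ y ↝ a ⊕ᶻ b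
↝-⊕ ε↝⊥₋  q     = q
↝-⊕ [ p ] ε↝⊥₋  = [ p ]
↝-⊕ {a = [ a ]} {[ b ]} [ p ] [ q ] = [ (λ n → ℚ.≃-trans (ℚ.⊔-cong (p n) (q n)) ⊔-hom) ]
  where
  ⊔-hom : mkℚᵘ a 0 ℚ.⊔ mkℚᵘ b 0 ℚ.≃ mkℚᵘ (a ℤ.⊔ b) 0
  ⊔-hom with ℤ.≤-total a b
  ... | inj₁ a≤b rewrite ℤ.i≤j⇒i⊔j≡j a≤b = ℚ.p≤q⇒p⊔q≃q (/1-mono-≤ a≤b)
  ... | inj₂ b≤a rewrite ℤ.i≥j⇒i⊔j≡i b≤a = ℚ.p≥q⇒p⊔q≃p (/1-mono-≤ b≤a)

↝-⊗ : ∀ {x y a b} → x ↝ a → y ↝ b → x ⊗ y ↝ a ⊗ᶻ b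
↝-⊗ ε↝⊥₋  _    = ε↝⊥₋
↝-⊗ [ _ ] ε↝⊥₋ = ε↝⊥₋
↝-⊗ {a = [ a ]} {[ b ]} [ p ] [ q ] =
  -- The sum samples at `double n`, which is harmless since `p` and `q` hold at every index.
  [ (λ n → ℚ.≃-trans (ℚ.+-cong (p (double n)) (q (double n))) +-hom) ]
  where
  +-hom : mkℚᵘ a 0 ℚ.+ mkℚᵘ b 0 ℚ.≃ mkℚᵘ (a ℤ.+ b) 0
  +-hom = ℚ.*≡* (cong (ℤ._* + 1) (cong₂ ℤ._+_ (ℤ.*-identityʳ a) (ℤ.*-identityʳ b)))

↝-⊗ₘ : ∀ {n} {A B : Matrix n} {M N} → A ↝ₘ M → B ↝ₘ N → A ⊗ₘ B ↝ₘ M ⊗ᶻₘ N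
↝-⊗ₘ p q i j = go λ l → ↝-⊗ (p i l) (q l j)
  where
  go : ∀ {m} {f : Fin m → ℝmax} {g : Fin m → ℤmax} → (∀ l → f l ↝ g l) →
       Vector.foldr _⊕_ ε f ↝ Vector.foldr _⊕ᶻ_ ⊥₋ g
  go {zero}  _ = ε↝⊥₋
  go {suc _} h = ↝-⊕ (h zero) (go (h ∘ suc))

↝-I : ∀ {n} → I {n} ↝ₘ Iᶻ
↝-I i j with i ≟ j
... | yes _ = ι-↝ [ + 0 ]
... | no  _ = ε↝⊥₋

↝-^ : ∀ {n} {A : Matrix n} {M} → A ↝ₘ M → ∀ k → A ^ k ↝ₘ M ⊗[ k ] Iᶻ
↝-^ p zero    = ↝-I
↝-^ p (suc k) = ↝-⊗ₘ p (↝-^ p k)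

↝-resp-≋ : ∀ {n} {A : Matrix n} {M N} → M ≋ N → A ↝ₘ M → A ↝ₘ N
↝-resp-≋ M≋N p i j = subst (_ ↝_) (M≋N i j) (p i j)

δ-nonNeg : ∀ n → 0ℚᵘ ℚ.≤ δ n ℚ.+ δ n
δ-nonNeg n = ℚ.+-mono-≤ (ℚ.nonNegative⁻¹ (δ n)) (ℚ.nonNegative⁻¹ (δ n))

↝-unique : ∀ {x y a} → x ↝ a → y ↝ a → x ≈ y
↝-unique ε↝⊥₋ ε↝⊥₋ = ⊥₋≈⊥₋
↝-unique {[ x ]} {[ y ]} {[ a ]} [ p ] [ q ] = [ (le {x} {y} p q , le {y} {x} q p) ]
  where
  le : ∀ {x y} → (∀ n → seq x n ℚ.≃ mkℚᵘ a 0) → (∀ n → seq y n ℚ.≃ mkℚᵘ a 0) → x ≤ᴿ y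
  le {x} {y} p q n = begin
    seq x n                       ≃⟨ ℚ.≃-trans (p n) (ℚ.≃-sym (q n)) ⟩
    seq y n                       ≃⟨ ℚ.≃-sym (ℚ.+-identityʳ (seq y n)) ⟩
    seq y n ℚ.+ 0ℚᵘ               ≤⟨ ℚ.+-monoʳ-≤ (seq y n) (δ-nonNeg n) ⟩
    seq y n ℚ.+ (δ n ℚ.+ δ n)     ∎
    where open ℚ.≤-Reasoning

-- The third terms of the sequences suffice: if a > b then a - b ≥ 1 > 1/3 + 1/3.
↝-≤ᴿ⇒≤ : ∀ {x y a b} → (∀ n → seq x n ℚ.≃ mkℚᵘ a 0) → (∀ n → seq y n ℚ.≃ mkℚᵘ b 0) →
          x ≤ᴿ y → a ℤ.≤ b
↝-≤ᴿ⇒≤ {x} {y} {a} {b} p q x≤y = ℤ.≮⇒≥ λ b<a → ℚ.<⇒≱ (lt b<a) (begin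
    mkℚᵘ a 0                            ≃⟨ ℚ.≃-sym (p 2) ⟩
    seq x 2                             ≤⟨ x≤y 2 ⟩
    seq y 2 ℚ.+ (δ 2 ℚ.+ δ 2)           ≃⟨ ℚ.+-congˡ (δ 2 ℚ.+ δ 2) (q 2) ⟩
    mkℚᵘ b 0 ℚ.+ (δ 2 ℚ.+ δ 2)          ∎)
  where
  open ℚ.≤-Reasoning
  lt : b ℤ.< a → mkℚᵘ b 0 ℚ.+ (δ 2 ℚ.+ δ 2) ℚ.< mkℚᵘ a 0
  lt b<a = begin-strict
    mkℚᵘ b 0 ℚ.+ (δ 2 ℚ.+ δ 2)  <⟨ ℚ.+-monoʳ-< (mkℚᵘ b 0) (from-yes ((δ 2 ℚ.+ δ 2) ℚ.<? δ 0)) ⟩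
    mkℚᵘ b 0 ℚ.+ δ 0            ≃⟨ ℚ.+-comm (mkℚᵘ b 0) (δ 0) ⟩
    δ 0 ℚ.+ mkℚᵘ b 0            ≃⟨ ℚ.*≡* (cong (ℤ._* + 1) (cong (λ z → + 1 ℤ.+ z) (ℤ.*-identityʳ b))) ⟩
    mkℚᵘ (ℤ.suc b) 0            ≤⟨ /1-mono-≤ (ℤ.i<j⇒suc[i]≤j b<a) ⟩
    mkℚᵘ a 0                    ∎

-- This turns a disagreement of integer entries, decided by computation, into a refutation of an
-- equation over ℝmax.
↝-injective : ∀ {x y a b} → x ↝ a → y ↝ b → x ≈ y → a ≡ b
↝-injective ε↝⊥₋  ε↝⊥₋  _               = refl
↝-injective {[ x ]} {[ y ]} [ p ] [ q ] [ (x≤y , y≤x) ] =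
  cong [_] (ℤ.≤-antisym (↝-≤ᴿ⇒≤ {x} {y} p q x≤y) (↝-≤ᴿ⇒≤ {y} {x} q p y≤x))

-- Writing `l` as `d + T`, one decidable equality of integer matrices yields the periodicity of all
-- later real powers.
^-periodic : ∀ {n} {A : Matrix n} {M p T} → A ↝ₘ M → M ⊗[ p + T ] Iᶻ ≋ M ⊗[ T ] Iᶻ →
             ∀ l → T ≤ℕ l → A ^ (l + p) ≈ₘ A ^ l
^-periodic {A = A} {M} {p} {T} A↝M periodic l T≤l i j =
  ↝-unique (↝-resp-≋ period (↝-^ A↝M (l + p)) i j) (↝-^ A↝M l i j)
  where
  d = l ℕ.∸ T
  l≡ : d + T ≡ l
  l≡ = ℕ.m∸n+n≡m T≤l
  l+p≡ : l + p ≡ d + (p + T)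
  l+p≡ = trans (cong (_+ p) (sym l≡)) (trans (ℕ.+-assoc d T p) (cong (λ m → d + m) (ℕ.+-comm T p)))
  period : M ⊗[ l + p ] Iᶻ ≋ M ⊗[ l ] Iᶻ
  period i j =
    trans (cong (λ k → (M ⊗[ k ] Iᶻ) i j) l+p≡)
    (trans (periodic-from {M = M} {Iᶻ} {p} {T} periodic d i j)
           (cong (λ k → (M ⊗[ k ] Iᶻ) i j) l≡))

-- Means

≃0⇒*≃0 : ∀ {p} q → p ℚ.≃ 0ℚᵘ → p ℚ.* q ℚ.≃ 0ℚᵘ
≃0⇒*≃0 q p≃0 = ℚ.≃-trans (ℚ.*-congʳ {q} p≃0) (ℚ.*-zeroˡ q)

-- Signs alone decide: a nonpositive weight has a nonpositive mean and a zero weight has mean zero,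
-- whatever the two lengths.
÷-nonPos : ∀ {x y a} {k l} .{{_ : NonZero k}} .{{_ : NonZero l}} →
           x ↝ a → a ≤ᶻ [ + 0 ] → y ↝ [ + 0 ] → x ÷ k ≤ y ÷ l
÷-nonPos ε↝⊥₋ _ _ = ⊥₋≤ _
÷-nonPos {[ x ]} {[ y ]} {[ a ]} {suc k} {suc l} [ p ] [ a≤0 ] [ q ] = [ le ]
  where
  le : (x ÷ᴿ suc k) ≤ᴿ (y ÷ᴿ suc l)
  le n = begin
    seq x n ℚ.* δ k                       ≃⟨ ℚ.*-congʳ {δ k} (p n) ⟩
    mkℚᵘ a 0 ℚ.* δ k                      ≤⟨ ℚ.*-monoˡ-≤-nonNeg (δ k) (/1-mono-≤ a≤0) ⟩
    0ℚᵘ ℚ.* δ k                           ≃⟨ ℚ.*-zeroˡ (δ k) ⟩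
    0ℚᵘ                                   ≤⟨ δ-nonNeg n ⟩
    δ n ℚ.+ δ n                           ≃⟨ ℚ.≃-sym (ℚ.+-identityˡ (δ n ℚ.+ δ n)) ⟩
    0ℚᵘ ℚ.+ (δ n ℚ.+ δ n)                 ≃⟨ ℚ.+-congˡ (δ n ℚ.+ δ n) (ℚ.≃-sym (≃0⇒*≃0 (δ l) (q n))) ⟩
    seq y n ℚ.* δ l ℚ.+ (δ n ℚ.+ δ n)     ∎
    where open ℚ.≤-Reasoning

÷-neg : ∀ {x y b} {k l} .{{_ : NonZero k}} .{{_ : NonZero l}} →
        x ↝ [ + 0 ] → y ↝ b → b ≤ᶻ [ -[1+ 0 ] ] → ¬ (x ÷ k ≤ y ÷ l)
÷-neg {k = suc k} [ _ ] ε↝⊥₋ _ ()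
÷-neg {[ x ]} {[ y ]} {[ b ]} {suc k} {suc l} [ p ] [ q ] [ b≤-1 ] [ x≤y ] =
  ℚ.<⇒≱ δ<δ (begin
    δ l                                               ≃⟨ ℚ.≃-sym (ℚ.+-identityʳ (δ l)) ⟩
    δ l ℚ.+ 0ℚᵘ                                       ≃⟨ ℚ.+-congʳ (δ l) (ℚ.≃-sym (≃0⇒*≃0 (δ k) (p n))) ⟩
    δ l ℚ.+ seq x n ℚ.* δ k                           ≤⟨ ℚ.+-monoʳ-≤ (δ l) (x≤y n) ⟩
    δ l ℚ.+ (seq y n ℚ.* δ l ℚ.+ (δ n ℚ.+ δ n))       ≃⟨ ℚ.+-congʳ (δ l) (ℚ.+-cong (ℚ.*-congʳ {δ l} (q n)) (δ-double (suc l))) ⟩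
    δ l ℚ.+ (mkℚᵘ b 0 ℚ.* δ l ℚ.+ δ (suc l))          ≤⟨ ℚ.+-monoʳ-≤ (δ l) (ℚ.+-monoˡ-≤ (δ (suc l)) bδ≤-δ) ⟩
    δ l ℚ.+ (ℚ.- ℚ.1ℚᵘ ℚ.* δ l ℚ.+ δ (suc l))         ≃⟨ cancel (δ l) (δ (suc l)) ⟩
    δ (suc l)                                         ∎)
  where
  open ℚ.≤-Reasoning
  -- At this index the tolerance `δ n + δ n` equals 1/(l+2), strictly below the gap 1/(l+1) between
  -- mean 0 and a mean of at most -1/(l+1).
  n = double (suc l)
  bδ≤-δ : mkℚᵘ b 0 ℚ.* δ l ℚ.≤ ℚ.- ℚ.1ℚᵘ ℚ.* δ l
  bδ≤-δ = ℚ.*-monoˡ-≤-nonNeg (δ l) (/1-mono-≤ b≤-1)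
  δ<δ : δ (suc l) ℚ.< δ l
  δ<δ = ℚ.*<* (ℤ.+<+ (ℕ.*-monoʳ-< 1 ℕ.≤-refl))
  cancel : ∀ d e → d ℚ.+ (ℚ.- ℚ.1ℚᵘ ℚ.* d ℚ.+ e) ℚ.≃ e
  cancel = solve 2 (λ d e → d :+ (con (ℚ.- ℚ.1ℚᵘ) :* d :+ e) := e) ℚ.≃-refl
    where open +-*-Solver

-- The two-cycle and the critical digraphs

module _ {G : Digraph 6} where

  twoCycle↺ : Edge G 0F 1F → Edge G 1F 0F → Cycle G
  twoCycle↺ e e′ = record
    { base       = 0F
    ; walk       = e ◅ e′ ◅ stop
    ; elementary = ((λ ()) ∷ []) ∷ [] ∷ []
    }

  module _ (G⊆twoCycle : ∀ {i j} → Edge G i j → Edge twoCycle i j) where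

    -- Two consecutive edges of the two-cycle return to their start, so edges can be removed in
    -- pairs; a single leftover edge would be a loop. Allowing every `G` inside `twoCycle` also
    -- covers the common digraph of arbitrary CSR data.
    closed-even : ∀ {i} (w : Star (Edge G) i i) → 2 ∣ List.length (edges w)
    closed-even stop       = 2 ∣0
    closed-even (e ◅ stop) with G⊆twoCycle e
    ... | inj₁ ()
    ... | inj₂ ()
    closed-even (e ◅ e′ ◅ w) with G⊆twoCycle e | G⊆twoCycle e′
    ... | inj₁ refl | inj₂ refl = ∣m∣n⇒∣m+n ∣-refl (closed-even w)
    ... | inj₂ refl | inj₁ refl = ∣m∣n⇒∣m+n ∣-refl (closed-even w)
    ... | inj₁ refl | inj₁ ()
    ... | inj₂ refl | inj₂ ()

twoCycle-cyclicity : IsCyclicity twoCycle 2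
twoCycle-cyclicity = record
  { stronglyConnected = λ
    { (inj₁ refl) (inj₁ refl) → stop
    ; (inj₁ refl) (inj₂ refl) → inj₁ refl ◅ stop
    ; (inj₂ refl) (inj₁ refl) → inj₂ refl ◅ stop
    ; (inj₂ refl) (inj₂ refl) → stop
    }
  ; divides           = λ c → closed-even {twoCycle} (λ e → e) (walk c)
  ; greatest          = λ _ d∣ → d∣ (twoCycle↺ (inj₁ refl) (inj₂ refl))
  }

-- The cycle of length 2 forces `γ` to divide 2, and the parity of closed walks forces 2 to divide
-- `γ`.
twoCycle-cyclicity-unique : ∀ {G γ} → G ≐ᴳ twoCycle → IsCyclicity G γ → γ ≡ 2
twoCycle-cyclicity-unique {G} (_ , G⇒ , ⇒G) cyc = ∣-antisym
  (IsCyclicity.divides cyc (twoCycle↺ (⇒G (inj₁ refl)) (⇒G (inj₂ refl))))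
  (IsCyclicity.greatest cyc 2 λ c → closed-even {G} G⇒ (walk c))

twoCycle-edge? : Decidable (Edge twoCycle)
twoCycle-edge? i j = ((0F , 1F) ≟₂ (i , j)) ⊎-dec ((1F , 0F) ≟₂ (i , j))
  where _≟₂_ = ≡-dec-× _≟_ _≟_

≐ᴳ-sym : ∀ {n} {G H : Digraph n} → G ≐ᴳ H → H ≐ᴳ G
≐ᴳ-sym ((n⇒ , n⇐) , e⇒ , e⇐) = (n⇐ , n⇒) , e⇐ , e⇒

≐ᴳ-trans : ∀ {n} {G H K : Digraph n} → G ≐ᴳ H → H ≐ᴳ K → G ≐ᴳ K
≐ᴳ-trans ((n⇒ , n⇐) , e⇒ , e⇐) ((n⇒′ , n⇐′) , e⇒′ , e⇐′) =
  ((λ x → n⇒′ (n⇒ x)) , (λ x → n⇐ (n⇐′ x))) , (λ x → e⇒′ (e⇒ x)) , (λ x → e⇐ (e⇐′ x))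

weightᶻ : ∀ {n} → ℤMatrix n → List (Fin n × Fin n) → ℤmax
weightᶻ M = List.foldr (λ (i , j) → M i j ⊗ᶻ_) [ + 0 ]

module _ {A : Matrix 6} {M : ℤMatrix 6} (A↝M : A ↝ₘ M)
         (on-twoCycle  : ∀ {i j} → Edge twoCycle i j → M i j ≡ [ + 0 ])
         (off-twoCycle : ∀ i j → Edge twoCycle i j ⊎ M i j ≤ᶻ [ -[1+ 0 ] ])
         where

  private
    nonPos : ∀ i j → M i j ≤ᶻ [ + 0 ]
    nonPos i j with off-twoCycle i j
    ... | inj₁ e    = ≤ᶻ-reflexive (on-twoCycle e)
    ... | inj₂ M≤-1 = ≤ᶻ-trans M≤-1 [ ℤ.-≤+ ]

    weight-nonPos : ∀ es → weightᶻ M es ≤ᶻ [ + 0 ]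
    weight-nonPos []             = [ ℤ.≤-refl ]
    weight-nonPos ((i , j) ∷ es) = ⊗ᶻ-mono-≤ (nonPos i j) (weight-nonPos es)

    weight-neg : ∀ {i j es} → (i , j) ∈ es → M i j ≤ᶻ [ -[1+ 0 ] ] →
                 weightᶻ M es ≤ᶻ [ -[1+ 0 ] ]
    weight-neg {es = _ ∷ es}      (here refl) M≤-1 = ⊗ᶻ-mono-≤ M≤-1 (weight-nonPos es)
    weight-neg {es = (i , j) ∷ _} (there e∈)  M≤-1 = ⊗ᶻ-mono-≤ (nonPos i j) (weight-neg e∈ M≤-1)

    weight-↝ : ∀ es → List.foldr (λ (i , j) → A i j ⊗_) 𝟘 es ↝ weightᶻ M es
    weight-↝ []             = ι-↝ [ + 0 ]
    weight-↝ ((i , j) ∷ es) = ↝-⊗ (A↝M i j) (weight-↝ es)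

    edge-present : ∀ {i j} → Edge twoCycle i j → A i j ≢ ε
    edge-present e A≡ε with trans (sym (on-twoCycle e)) (≡ε⇒≡⊥₋ (A↝M _ _) A≡ε)
    ... | ()

    c₂ : Cycle (associated A)
    c₂ = twoCycle↺ (edge-present (inj₁ refl)) (edge-present (inj₂ refl))

    c₂-weight : weight A c₂ ↝ [ + 0 ]
    c₂-weight = subst (weight A c₂ ↝_)
      (cong₂ (λ a b → a ⊗ᶻ (b ⊗ᶻ [ + 0 ])) (on-twoCycle (inj₁ refl)) (on-twoCycle (inj₂ refl)))
      (weight-↝ (edges (walk c₂)))

    c₂-maximal : MaximalMean A c₂
    c₂-maximal c = ÷-nonPos (weight-↝ (edges (walk c))) (weight-nonPos (edges (walk c))) c₂-weight

    -- No edge has positive weight, so a cycle using an edge of weight at most -1 has negative mean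
    -- and is beaten by `c₂`, whose mean is 0.
    critical-edge : ∀ {i j} → Edge (critical A) i j → Edge twoCycle i j
    critical-edge {i} {j} (c , c-maximal , e∈) with off-twoCycle i j
    ... | inj₁ e    = e
    ... | inj₂ M≤-1 = contradiction (c-maximal c₂)
      (÷-neg c₂-weight (weight-↝ (edges (walk c))) (weight-neg e∈ M≤-1))

    critical-node : ∀ {i} → Node (critical A) i → Node twoCycle i
    -- Each node of a cycle is the source of one of its edges, which reduces the claim to edges.
    critical-node (c , c-maximal , i∈) with ∈-map⁻ proj₁ i∈
    ... | (i , j) , e∈ , refl with critical-edge (c , c-maximal , e∈)
    ... | inj₁ refl = inj₁ refl
    ... | inj₂ refl = inj₂ refl

  critical≐twoCycle : critical A ≐ᴳ twoCycle
  critical≐twoCycle =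
      ( critical-node
      , λ { (inj₁ refl) → c₂ , c₂-maximal , here refl
          ; (inj₂ refl) → c₂ , c₂-maximal , there (here refl) } )
    , critical-edge
    , λ { (inj₁ refl) → c₂ , c₂-maximal , here refl
        ; (inj₂ refl) → c₂ , c₂-maximal , there (here refl) }

associated-⊆ : ∀ {n} {A B : Matrix n} {M N : ℤMatrix n} → A ↝ₘ M → B ↝ₘ N →
               (∀ i j → N i j ≡ ⊥₋ → M i j ≡ ⊥₋) →
               ∀ {i j} → Edge (associated A) i j → Edge (associated B) i j
associated-⊆ p q N⇒M {i} {j} A≢ε B≡ε = A≢ε (≡⊥₋⇒≡ε (p i j) (N⇒M i j (≡ε⇒≡⊥₋ (q i j) B≡ε)))

-- The matrices A₁, A₂ and S

fromRowsᶻ : ∀ {n} → Vec (Vec ℤmax n) n → ℤMatrix n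
fromRowsᶻ rows i j = Vec.lookup (Vec.lookup rows i) j

↝-fromRows : ∀ {n} (rows : Vec (Vec ℤmax n) n) →
             fromRows (Vec.map (Vec.map ι) rows) ↝ₘ fromRowsᶻ rows
↝-fromRows rows i j
  rewrite lookup-map i (Vec.map ι) rows | lookup-map j ι (Vec.lookup rows i) = ι-↝ _

-- The parameter is the weight of the edges 2 → 5 and 4 → 1 (nodes numbered from 1), the only
-- entries in which the two matrices differ.
rowsA : ℤ → Vec (Vec ℤmax 6) 6
rowsA w =
    (⊥₋      ∷ [ + 0 ] ∷ [ h ] ∷ ⊥₋    ∷ ⊥₋    ∷ ⊥₋    ∷ [])
  ∷ ([ + 0 ] ∷ ⊥₋      ∷ ⊥₋    ∷ ⊥₋    ∷ [ w ] ∷ ⊥₋    ∷ [])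
  ∷ (⊥₋      ∷ ⊥₋      ∷ ⊥₋    ∷ [ h ] ∷ ⊥₋    ∷ ⊥₋    ∷ [])
  ∷ ([ w ]   ∷ ⊥₋      ∷ ⊥₋    ∷ ⊥₋    ∷ ⊥₋    ∷ ⊥₋    ∷ [])
  ∷ (⊥₋      ∷ ⊥₋      ∷ ⊥₋    ∷ ⊥₋    ∷ ⊥₋    ∷ [ h ] ∷ [])
  ∷ (⊥₋      ∷ [ h ]   ∷ ⊥₋    ∷ ⊥₋    ∷ ⊥₋    ∷ ⊥₋    ∷ [])
  ∷ []
  where h = ℤ.- + 100

rowsS : Vec (Vec ℤmax 6) 6
rowsS =
    (⊥₋      ∷ [ + 0 ] ∷ ⊥⁴)
  ∷ ([ + 0 ] ∷ ⊥₋      ∷ ⊥⁴)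
  ∷ Vec.replicate 4 (⊥₋ ∷ ⊥₋ ∷ ⊥⁴)
  where ⊥⁴ = Vec.replicate 4 ⊥₋

M₁ M₂ Mₛ : ℤMatrix 6
M₁ = fromRowsᶻ (rowsA (ℤ.- + 100))
M₂ = fromRowsᶻ (rowsA (ℤ.- + 1))
Mₛ = fromRowsᶻ rowsS

A₁↝M₁ : A₁ ↝ₘ M₁
A₁↝M₁ = ↝-fromRows (rowsA (ℤ.- + 100))

A₂↝M₂ : A₂ ↝ₘ M₂
A₂↝M₂ = ↝-fromRows (rowsA (ℤ.- + 1))

associated-A₁≐A₂ : associated A₁ ≐ᴳ associated A₂
associated-A₁≐A₂ =
    ((λ _ → _) , (λ _ → _))
  , (λ {i} {j} → associated-⊆ A₁↝M₁ A₂↝M₂ (from-yes (⊥₋-⊆? M₂ M₁)) {i} {j})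
  , (λ {i} {j} → associated-⊆ A₂↝M₂ A₁↝M₁ (from-yes (⊥₋-⊆? M₁ M₂)) {i} {j})
  where
  ⊥₋-⊆? : ∀ (M N : ℤMatrix 6) → Dec (∀ i j → M i j ≡ ⊥₋ → N i j ≡ ⊥₋)
  ⊥₋-⊆? M N = all? λ i → all? λ j → (M i j ≟ᶻ ⊥₋) →-dec (N i j ≟ᶻ ⊥₋)

associated-A₁-primitive : Primitive (associated A₁)
associated-A₁-primitive = record
  { stronglyConnected = λ {i} {j} _ _ → to0 i ◅◅ from0 j
  ; divides           = λ _ → 1∣ _
  -- The cycles 1 → 3 → 4 → 1 and 1 → 2 → 1 have lengths 3 = 2 + 1 and 2, so a common divisor
  -- divides 1.
  ; greatest          = λ d d∣ → ∣m+n∣m⇒∣n {m = 2} {n = 1} (d∣ c₃) (d∣ (twoCycle↺ (λ ()) (λ ())))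
  }
  where
  from0 : ∀ j → Star (Edge (associated A₁)) 0F j
  from0 0F = stop
  from0 1F = (λ ()) ◅ stop
  from0 2F = (λ ()) ◅ stop
  from0 3F = _◅_ {j = 2F} (λ ()) ((λ ()) ◅ stop)
  from0 4F = _◅_ {j = 1F} (λ ()) ((λ ()) ◅ stop)
  from0 5F = _◅_ {j = 1F} (λ ()) (_◅_ {j = 4F} (λ ()) ((λ ()) ◅ stop))
  to0 : ∀ i → Star (Edge (associated A₁)) i 0F
  to0 0F = stop
  to0 1F = (λ ()) ◅ stop
  to0 2F = _◅_ {j = 3F} (λ ()) ((λ ()) ◅ stop)
  to0 3F = (λ ()) ◅ stop
  to0 4F = _◅_ {j = 5F} (λ ()) (_◅_ {j = 1F} (λ ()) ((λ ()) ◅ stop))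
  to0 5F = _◅_ {j = 1F} (λ ()) ((λ ()) ◅ stop)
  c₃ : Cycle (associated A₁)
  c₃ = record
    { base       = 0F
    ; walk       = _◅_ {j = 2F} (λ ()) (_◅_ {j = 3F} (λ ()) ((λ ()) ◅ stop))
    ; elementary = ((λ ()) ∷ (λ ()) ∷ []) ∷ ((λ ()) ∷ []) ∷ [] ∷ []
    }

critical-A₁ : critical A₁ ≐ᴳ twoCycle
critical-A₁ = critical≐twoCycle A₁↝M₁ (λ { (inj₁ refl) → refl ; (inj₂ refl) → refl })
  (from-yes (all? λ i → all? λ j → twoCycle-edge? i j ⊎-dec (M₁ i j ≤ᶻ? [ -[1+ 0 ] ])))

critical-A₂ : critical A₂ ≐ᴳ twoCycle
critical-A₂ = critical≐twoCycle A₂↝M₂ (λ { (inj₁ refl) → refl ; (inj₂ refl) → refl })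
  (from-yes (all? λ i → all? λ j → twoCycle-edge? i j ⊎-dec (M₂ i j ≤ᶻ? [ -[1+ 0 ] ])))

Mₛ-edge : ∀ {i j} → Edge twoCycle i j → Mₛ i j ≡ [ + 0 ]
Mₛ-edge (inj₁ refl) = refl
Mₛ-edge (inj₂ refl) = refl

Mₛ-nonEdge : ∀ {i j} → ¬ Edge twoCycle i j → Mₛ i j ≡ ⊥₋
Mₛ-nonEdge {i} {j} ¬e
  with from-yes (all? λ i → all? λ j → twoCycle-edge? i j ⊎-dec (Mₛ i j ≟ᶻ ⊥₋)) i j
... | inj₁ e  = contradiction e ¬e
... | inj₂ eq = eq

S₂ : Matrix 6
S₂ = fromRows (Vec.map (Vec.map ι) rowsS)

S₂↝Mₛ : S₂ ↝ₘ Mₛ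
S₂↝Mₛ = ↝-fromRows rowsS

-- `Mₛ` swaps the first two nodes and annihilates the others, so its positive powers alternate
-- between this swap and the identity restricted to the two nodes.
Mₛ-periodic : Mₛ ⊗[ 2 + 1 ] Iᶻ ≋ Mₛ ⊗[ 1 ] Iᶻ
Mₛ-periodic = from-yes ((Mₛ ⊗[ 2 + 1 ] Iᶻ) ≋? (Mₛ ⊗[ 1 ] Iᶻ))

-- An inhabitant is exhibited because without one every statement `¬ CSR 𝒜 k Γ` would hold
-- vacuously.
csrData : CSRData 𝒜
csrData = record
  { common      = twoCycle
  ; isCommon    = λ { (inj₁ refl) → critical-A₁ ; (inj₂ refl) → critical-A₂ }
  ; γ           = 2
  ; isCyclicity = twoCycle-cyclicity
  ; S           = S₂
  ; S-edge      = λ { (inj₁ refl) → refl ; (inj₂ refl) → refl }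
  ; S-nonEdge   = λ {i} {j} ¬e → ≡⊥₋⇒≡ε (S₂↝Mₛ i j) (Mₛ-nonEdge ¬e)
  ; T           = 1
  ; T-periodic  = ^-periodic S₂↝Mₛ Mₛ-periodic
  -- Period 2 fails at exponent 0: outside the critical nodes, `I` has diagonal entry 0 while the
  -- square of `S₂` has ε.
  ; T-least     = λ { zero p → contradiction
                        (↝-injective (↝-^ S₂↝Mₛ 2 2F 2F) (↝-^ S₂↝Mₛ 0 2F 2F) (p 0 z≤n 2F 2F))
                        (λ ())
                    ; (suc _) _ → s≤s z≤n }
  ; t₀          = 1
  ; t₀γ≥T       = s≤s z≤n
  }

-- Failure of the CSR equation

-- Periodicity makes t₀ irrelevant, so it is taken to be 0.
CSRᶻ : ∀ {n} → ℤMatrix n → ℕ → ℤMatrix n → ℤMatrix n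
CSRᶻ M r G = (G ⊗ᶻₘ (M ⊗[ 2 ℕ.∸ r ] Iᶻ)) ⊗ᶻₘ (M ⊗[ r ] Iᶻ) ⊗ᶻₘ ((M ⊗[ 2 ℕ.∸ r ] Iᶻ) ⊗ᶻₘ G)

module _ {n} {S : Matrix n} {M : ℤMatrix n} (S↝M : S ↝ₘ M)
         (periodic : M ⊗[ 2 + 1 ] Iᶻ ≋ M ⊗[ 1 ] Iᶻ) where

  power-v-↝ : ∀ r → r ℕ.< 2 → ∀ t₀ → S ^ (suc t₀ * 2 ℕ.∸ r) ↝ₘ M ⊗[ 2 ℕ.∸ r ] Iᶻ
  power-v-↝ r r<2 t₀ = ↝-resp-≋ M^v≋ (↝-^ S↝M (suc t₀ * 2 ℕ.∸ r))
    where
    v≡ : suc t₀ * 2 ℕ.∸ r ≡ t₀ * 2 + (2 ℕ.∸ r)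
    v≡ = trans (cong (ℕ._∸ r) (ℕ.+-comm 2 (t₀ * 2))) (ℕ.+-∸-assoc (t₀ * 2) (ℕ.<⇒≤ r<2))
    by-remainder : ∀ r → r ℕ.< 2 → M ⊗[ t₀ * 2 + (2 ℕ.∸ r) ] Iᶻ ≋ M ⊗[ 2 ℕ.∸ r ] Iᶻ
    -- For remainder 0 the remaining exponent is 2, so the coincidence at exponent 1 is first
    -- advanced by one.
    by-remainder 0 _ = periodic-multiple {M = M} {Iᶻ} {2} {2}
                         (periodic-from {M = M} {Iᶻ} {2} {1} periodic 1) t₀
    by-remainder 1 _ = periodic-multiple {M = M} {Iᶻ} {2} {1} periodic t₀
    by-remainder (suc (suc _)) (s≤s (s≤s ()))
    M^v≋ : M ⊗[ suc t₀ * 2 ℕ.∸ r ] Iᶻ ≋ M ⊗[ 2 ℕ.∸ r ] Iᶻ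
    M^v≋ i j = trans (cong (λ k → (M ⊗[ k ] Iᶻ) i j) v≡) (by-remainder r r<2 i j)

  -- `γ` is a separate variable so that `γ ≡ 2` can be matched with `refl`, which turns all
  -- exponents and remainders into those for 2.
  CSR-↝ : ∀ {Γ : Matrix n} {G} → Γ ↝ₘ G → ∀ {γ} .{{_ : NonZero γ}} → γ ≡ 2 → ∀ k t₀ →
          let v = suc t₀ * γ ℕ.∸ k % γ in
          (Γ ⊗ₘ S ^ v) ⊗ₘ S ^ (k % γ) ⊗ₘ (S ^ v ⊗ₘ Γ) ↝ₘ CSRᶻ M (k % 2) G
  CSR-↝ Γ↝G refl k t₀ = ↝-⊗ₘ (↝-⊗ₘ (↝-⊗ₘ Γ↝G S^v↝) (↝-^ S↝M (k % 2))) (↝-⊗ₘ S^v↝ Γ↝G)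
    where S^v↝ = power-v-↝ (k % 2) (m%n<n k 2) t₀

module _ {n} {𝒳 : Pred (Matrix n) 0ℓ} {M : ℤMatrix n}
         (γ≡2 : (D : CSRData 𝒳) → CSRData.γ D ≡ 2)
         (S↝M : (D : CSRData 𝒳) → CSRData.S D ↝ₘ M)
         (periodic : M ⊗[ 2 + 1 ] Iᶻ ≋ M ⊗[ 1 ] Iᶻ) where

  CSR⇒≋CSRᶻ : ∀ {k Γ G} → Γ ↝ₘ G → CSR 𝒳 k Γ → G ≋ CSRᶻ M (k % 2) G
  CSR⇒≋CSRᶻ {k} Γ↝G (D , Γ≈CSR) i j =
    ↝-injective (Γ↝G i j) (CSR-↝ (S↝M D) periodic Γ↝G (γ≡2 D) k (CSRData.t₀ D) i j) (Γ≈CSR i j)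

  -- `G` may contain a free exponent and then does not evaluate; `H` is an equal matrix, closed in
  -- the applications, in which a single entry is compared.
  ¬CSR : ∀ {k r Γ G} H i j → Γ ↝ₘ G → G ≋ H → k % 2 ≡ r →
         H i j ≢ CSRᶻ M r H i j → ¬ CSR 𝒳 k Γ
  ¬CSR {k} H i j Γ↝G G≋H refl H≢ csr = H≢ (CSR⇒≋CSRᶻ {k} (↝-resp-≋ G≋H Γ↝G) csr i j)

module _ (D : CSRData 𝒜) where

  open CSRData D

  common≐twoCycle : common ≐ᴳ twoCycle
  common≐twoCycle = ≐ᴳ-trans (≐ᴳ-sym (isCommon (inj₁ refl))) critical-A₁

  γ≡2 : γ ≡ 2
  γ≡2 = twoCycle-cyclicity-unique common≐twoCycle isCyclicity

  -- The data prescribe `S` only on edges and on non-edges; this fixes every entry because being an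
  -- edge of `twoCycle` is decidable.
  S↝Mₛ : S ↝ₘ Mₛ
  S↝Mₛ i j = case twoCycle-edge? i j of λ where
    (yes e) → subst₂ _↝_ (sym (S-edge (proj₂ (proj₂ common≐twoCycle) e))) (sym (Mₛ-edge e))
                         (ι-↝ [ + 0 ])
    (no ¬e) → subst₂ _↝_ (sym (S-nonEdge (λ e → ¬e (proj₁ (proj₂ common≐twoCycle) e))))
                         (sym (Mₛ-nonEdge ¬e)) ε↝⊥₋

-- The products of a power of A₁ with A₂

Γᶻ : ℕ → ℤMatrix 6
Γᶻ k = (M₁ ⊗[ k ] Iᶻ) ⊗ᶻₘ M₂

↝-Γᶻ : ∀ k → A₁ ^ k ⊗ₘ A₂ ↝ₘ Γᶻ k
↝-Γᶻ k = ↝-⊗ₘ (↝-^ A₁↝M₁ k) A₂↝M₂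

-- There is one base exponent for each parity: 7 for the odd powers and, below, 8 for the even ones.
M₁-periodic₇ : M₁ ⊗[ 9 ] Iᶻ ≋ M₁ ⊗[ 7 ] Iᶻ
M₁-periodic₇ = from-yes ((M₁ ⊗[ 9 ] Iᶻ) ≋? (M₁ ⊗[ 7 ] Iᶻ))

M₁-periodic₈ : M₁ ⊗[ 10 ] Iᶻ ≋ M₁ ⊗[ 8 ] Iᶻ
M₁-periodic₈ = from-yes ((M₁ ⊗[ 10 ] Iᶻ) ≋? (M₁ ⊗[ 8 ] Iᶻ))

Γᶻ-periodic : ∀ T → M₁ ⊗[ 2 + T ] Iᶻ ≋ M₁ ⊗[ T ] Iᶻ → ∀ q → Γᶻ (q * 2 + T) ≋ Γᶻ T
Γᶻ-periodic T periodic q =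
  ⊗ᶻₘ-cong {N = M₂} {M₂} (periodic-multiple {M = M₁} {Iᶻ} {2} {T} periodic q) (λ _ _ → refl)

Obstruction : ℕ → ℤMatrix 6 → Fin 6 → Fin 6 → Set
Obstruction r G i j = G i j ≢ CSRᶻ Mₛ r G i j

obstruction? : ∀ r G i j → Dec (Obstruction r G i j)
obstruction? r G i j = ¬? (G i j ≟ᶻ CSRᶻ Mₛ r G i j)

obstructed : ∀ {k r Γ G} H i j → Γ ↝ₘ G → G ≋ H → k % 2 ≡ r →
             Obstruction r H i j → ¬ CSR 𝒜 k Γ
obstructed {k} = ¬CSR γ≡2 S↝Mₛ Mₛ-periodic {k}

-- Numerals are converted below by substitution along refl: a direct comparison of
-- A₁ ^ 4 with A₁ ^ (2 * 2) makes Agda unfold both matrices.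
NotCSR : ℕ → ℕ → Set₁
NotCSR l k = ¬ CSR 𝒜 l (A₁ ^ k ⊗ₘ A₂)

Γᶻ-obstructed : ∀ {l r} k i j → l % 2 ≡ r → Obstruction r (Γᶻ k) i j → NotCSR l k
Γᶻ-obstructed {l} k i j = obstructed {l} (Γᶻ k) i j (↝-Γᶻ k) (λ _ _ → refl)

Γᶻ-obstructed-from : ∀ {l r} T i j → M₁ ⊗[ 2 + T ] Iᶻ ≋ M₁ ⊗[ T ] Iᶻ → ∀ q → l % 2 ≡ r →
                     Obstruction r (Γᶻ T) i j → NotCSR l (q * 2 + T)
Γᶻ-obstructed-from {l} T i j periodic q =
  obstructed {l} (Γᶻ T) i j (↝-Γᶻ (q * 2 + T)) (Γᶻ-periodic T periodic q)

-- Exponents 4 and 6 lie below the base exponent and are checked individually; 8 stands for all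
-- later even ones. The remainder is 1 because the factor A₂ makes the length odd.
even-obstructions : Obstruction 1 (Γᶻ 4) 0F 4F × Obstruction 1 (Γᶻ 6) 0F 4F
                  × Obstruction 1 (Γᶻ 8) 0F 4F
even-obstructions = from-yes (obstructed? 4 ×-dec obstructed? 6 ×-dec obstructed? 8)
  where obstructed? = λ k → obstruction? 1 (Γᶻ k) 0F 4F

odd-obstructions : Obstruction 0 (Γᶻ 3) 1F 4F × Obstruction 0 (Γᶻ 5) 1F 4F
                 × Obstruction 0 (Γᶻ 7) 1F 4F
odd-obstructions = from-yes (obstructed? 3 ×-dec obstructed? 5 ×-dec obstructed? 7)
  where obstructed? = λ k → obstruction? 0 (Γᶻ k) 1F 4F

even-product : ∀ t → 2 ≤ℕ t → NotCSR (2 * t + 1) (2 * t)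
even-product 0 ()
even-product 1 (s≤s ())
even-product 2 _ =
  subst₂ NotCSR {5} {_} {4} refl refl
    (Γᶻ-obstructed {5} {1} 4 0F 4F refl (proj₁ even-obstructions))
even-product 3 _ =
  subst₂ NotCSR {7} {_} {6} refl refl
    (Γᶻ-obstructed {7} {1} 6 0F 4F refl (proj₁ (proj₂ even-obstructions)))
even-product (suc (suc (suc (suc q)))) _ =
  subst₂ NotCSR (length≡ q) (power≡ q)
    (Γᶻ-obstructed-from {9 + q * 2} {1} 8 0F 4F M₁-periodic₈ q ([m+kn]%n≡m%n 9 q 2)
      (proj₂ (proj₂ even-obstructions)))
  where
  length≡ : ∀ q → 9 + q * 2 ≡ 2 * (4 + q) + 1
  length≡ = solve-∀
  power≡ : ∀ q → q * 2 + 8 ≡ 2 * (4 + q)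
  power≡ = solve-∀

odd-product : ∀ t → 1 ≤ℕ t → NotCSR (2 * t + 2) (2 * t + 1)
odd-product 0 ()
odd-product 1 _ =
  subst₂ NotCSR {4} {_} {3} refl refl
    (Γᶻ-obstructed {4} {0} 3 1F 4F refl (proj₁ odd-obstructions))
odd-product 2 _ =
  subst₂ NotCSR {6} {_} {5} refl refl
    (Γᶻ-obstructed {6} {0} 5 1F 4F refl (proj₁ (proj₂ odd-obstructions)))
odd-product (suc (suc (suc q))) _ =
  subst₂ NotCSR (length≡ q) (power≡ q)
    (Γᶻ-obstructed-from {8 + q * 2} {0} 7 1F 4F M₁-periodic₇ q ([m+kn]%n≡m%n 8 q 2)
      (proj₂ (proj₂ odd-obstructions)))
  where
  length≡ : ∀ q → 8 + q * 2 ≡ 2 * (3 + q) + 2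
  length≡ = solve-∀
  power≡ : ∀ q → q * 2 + 7 ≡ 2 * (3 + q) + 1
  power≡ = solve-∀

-- Arbitrarily long words

word : ∀ k → Vec (Matrix 6) (suc k)
word zero    = A₂ ∷ []
word (suc k) = A₁ ∷ word k

word⊆𝒜 : ∀ k → All 𝒜 (word k)
word⊆𝒜 zero    = inj₂ refl ∷ []
word⊆𝒜 (suc k) = inj₁ refl ∷ word⊆𝒜 k

-- `⨂` nests to the right and ends in A₂ ⊗ I. The seed `M₂ ⊗ᶻₘ Iᶻ` reproduces this bracketing
-- exactly, so no associativity or unit law is invoked.
↝-word : ∀ k → ⨂ (word k) ↝ₘ M₁ ⊗[ k ] (M₂ ⊗ᶻₘ Iᶻ)
↝-word zero    = ↝-⊗ₘ A₂↝M₂ ↝-I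
↝-word (suc k) = ↝-⊗ₘ A₁↝M₁ (↝-word k)

-- Even exponents from 8 on already give unbounded lengths, so one base evaluation and one entry
-- comparison suffice.
word-obstructed : ∀ q → ¬ CSR 𝒜 (suc (q * 2 + 8)) (⨂ (word (q * 2 + 8)))
word-obstructed q =
  obstructed {suc (q * 2 + 8)} {1} (M₁ ⊗[ 8 ] (M₂ ⊗ᶻₘ Iᶻ)) 0F 4F (↝-word (q * 2 + 8))
    (periodic-multiple {M = M₁} {M₂ ⊗ᶻₘ Iᶻ} {2} {8}
      (from-yes ((M₁ ⊗[ 10 ] (M₂ ⊗ᶻₘ Iᶻ)) ≋? (M₁ ⊗[ 8 ] (M₂ ⊗ᶻₘ Iᶻ)))) q)
    (trans (cong (λ m → suc m % 2) (ℕ.+-comm (q * 2) 8)) ([m+kn]%n≡m%n 9 q 2))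
    (from-yes (obstruction? 1 (M₁ ⊗[ 8 ] (M₂ ⊗ᶻₘ Iᶻ)) 0F 4F))

mainTheorem4 : associated A₁ ≐ᴳ associated A₂
    × Primitive (associated A₁)
    × critical A₁ ≐ᴳ twoCycle
    × critical A₂ ≐ᴳ twoCycle
    × IsCyclicity twoCycle 2
    × CSRData 𝒜
    × (∀ t → 2 ≤ℕ t → ¬ CSR 𝒜 (2 * t + 1) (A₁ ^ (2 * t) ⊗ₘ A₂))
    × (∀ t → 1 ≤ℕ t → ¬ CSR 𝒜 (2 * t + 2) (A₁ ^ (2 * t + 1) ⊗ₘ A₂))
    × (∀ N → ∃[ k ] N ≤ℕ k × (∃[ Γs ] All 𝒜 {k} Γs × ¬ CSR 𝒜 k (⨂ Γs)))
mainTheorem4 =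
    associated-A₁≐A₂ , associated-A₁-primitive , critical-A₁ , critical-A₂ , twoCycle-cyclicity
  , csrData , even-product , odd-product
  , λ N → let k = N * 2 + 8 in
      suc k , ℕ.m≤n⇒m≤1+n (ℕ.≤-trans (ℕ.m≤m*n N 2) (ℕ.m≤m+n (N * 2) 8))
    , word k , word⊆𝒜 k , word-obstructed N
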